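{- For every integer $k\ge 3$ there are infinitely many (pairwise non-isomorphic) finite $2$-regular, asymmetric $k$-graphs.
   Context: For $k\ge 2$, a $k$-graph ($k$-uniform hypergraph) is a pair $\mathcal{G}=(\mathcal{V}(\mathcal{G}),\mathcal{E}(\mathcal{G}))$ where the edge set $\mathcal{E}(\mathcal{G})$ is a set of $k$-element subsets of the finite vertex set $\mathcal{V}(\mathcal{G})$. An automorphism on a $k$-graph $\mathcal{G}=(\mathcal{V},\mathcal{E})$ is a bijection $\phi\colon\mathcal{V}\to\mathcal{V}$ such that for every $E\in\mathcal{E}$, $\{\phi(v): v\in E\}\in\mathcal{E}$. $\mathcal{G}$ is asymmetric if the identity is the only automorphism on $\mathcal{G}$. The degree of a vertex is the number of edges containing it. A $k$-graph is $r$-regular if every vertex has degree $r$. -}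

module Defs where

open import Data.Fin using (Fin)
open import Data.Fin.Properties using (any?; _≟_)
open import Data.Fin.Subset using (Subset; ∣_∣)
open import Data.Fin.Subset.Properties using (_∈?_)
open import Data.List using (List; length; filter)
open import Data.List.Membership.Propositional using () renaming (_∈_ to _∈ₗ_)
open import Data.List.Relation.Unary.All using (All)
open import Data.List.Relation.Unary.Unique.Propositional using (Unique)
open import Data.Nat using (ℕ)
open import Data.Product using (Σ-syntax)
open import Data.Vec using (tabulate)
open import Function.Bundles using (_⇔_)
open import Function.Definitions using (Bijective)
open import Relation.Binary.PropositionalEquality using (_≡_)
open import Relation.Nullary.Decidable using (does; _×-dec_)

-- The edge set is a duplicate-free list. Its order is irrelevant: everything
-- below depends only on list membership or on the number of entries.
record KGraph (k : ℕ) : Set where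
  field
    order   : ℕ
    edges   : List (Subset order)
    unique  : Unique edges
    uniform : All (λ E → ∣ E ∣ ≡ k) edges

  Vertex : Set
  Vertex = Fin order

  IsEdge : Subset order → Set
  IsEdge E = E ∈ₗ edges

  degree : Vertex → ℕ
  degree v = length (filter (v ∈?_) edges)

open KGraph public

-- The direct image { φ v : v ∈ S }.
image : ∀ {m n} → (Fin m → Fin n) → Subset m → Subset n
image φ S = tabulate λ w → does (any? λ v → (v ∈? S) ×-dec (φ v ≟ w))

record IsAutomorphism {k} (G : KGraph k) (φ : Vertex G → Vertex G) : Set where
  field
    bijective : Bijective _≡_ _≡_ φ
    preserves : ∀ E → IsEdge G E → IsEdge G (image φ E)

Asymmetric : ∀ {k} → KGraph k → Set
Asymmetric G = ∀ φ → IsAutomorphism G φ → ∀ v → φ v ≡ v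

Regular : ∀ {k} → ℕ → KGraph k → Set
Regular r G = ∀ v → degree G v ≡ r

record IsIsomorphism {k} (G H : KGraph k) (φ : Vertex G → Vertex H) : Set where
  field
    bijective : Bijective _≡_ _≡_ φ
    edges⇔    : ∀ E → IsEdge G E ⇔ IsEdge H (image φ E)

infix 4 _≅_

_≅_ : ∀ {k} → KGraph k → KGraph k → Set
G ≅ H = Σ[ φ ∈ (Vertex G → Vertex H) ] IsIsomorphism G H φ

{-# OPTIONS --safe #-}
module Submission where

-- A 2-regular k-graph is dual to a k-regular simple graph, so it suffices to find asymmetric
-- k-regular graphs. Take a cycle of cells t, with rotation ρ, and a fixed-point-free involution ω
-- on them (a chord diagram). The graph is bipartite, with nodes (b , t , r) for a side b and
-- 0 ≤ r < k; the q-th neighbour of (true , t , r) is (false , t′ , q), where t′ = ω t if r = q = 0,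
-- t′ = ρ t if r + q > k, and t′ = t otherwise. Up to reversing ρ the two sides look alike.
--
-- The signature of a node is the vector of the cells of its neighbours. Two nodes share all but
-- one neighbour exactly if their signatures differ in one entry, and this happens only between
-- (b , t , r) and (b , t , r + 1). Hence an automorphism permutes the cells; it fixes or swaps the
-- sides and induces a rotation or a reflection of the chord diagram. The diagram is chosen
-- rigid: ω t = ρ³ t only for t = 0, and the chords near 0 are not mirror-symmetric. Once the
-- cells are fixed, (b , t , 0) is recognised by its chord and the other nodes follow along the chain.

open import Data.Bool using (Bool; true; false; not; if_then_else_)
import Data.Bool.Properties as Bool
open import Data.Empty using (⊥-elim)
open import Data.Fin as Fin
  using (Fin; zero; suc; toℕ; inject₁; fromℕ; fromℕ<; join; splitAt; _↑ʳ_; combine; remQuot)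
open import Data.Fin.Induction using (<-weakInduction)
open import Data.Fin.Patterns
import Data.Fin.Properties as Fin
open import Data.Fin.Relation.Unary.Top using (view; ‵fromℕ; ‵inject₁; view-fromℕ; view-inject₁)
open import Data.Fin.Subset using (Subset; ∣_∣; _∈_; inside; outside)
open import Data.Fin.Subset.Properties using (_∈?_)
open import Data.List as List using (List; []; _∷_; length; filter; map; allFin; cartesianProduct)
open import Data.List.Membership.Propositional using () renaming (_∈_ to _∈ₗ_)
open import Data.List.Membership.Propositional.Properties
  using (∈-map⁺; ∈-map⁻; ∈-filter⁺; ∈-filter⁻; ∈-tabulate⁺; ∈-tabulate⁻; ∈-allFin; ∈-cartesianProduct⁺)
open import Data.List.Membership.Propositional.Properties.WithK using (unique∧set⇒bag)
open import Data.List.Properties using (length-map; length-tabulate)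
open import Data.List.Relation.Binary.BagAndSetEquality using (∼bag⇒↭)
open import Data.List.Relation.Binary.Permutation.Propositional.Properties using (↭-length)
open import Data.List.Relation.Unary.All as All using ([]; _∷_)
import Data.List.Relation.Unary.All.Properties as All
open import Data.List.Relation.Unary.AllPairs using ([]; _∷_)
open import Data.List.Relation.Unary.Any using (here; there)
open import Data.List.Relation.Unary.Unique.Propositional using (Unique)
import Data.List.Relation.Unary.Unique.Propositional.Properties as Unique
open import Data.Nat using (ℕ; zero; suc; _+_; _*_; _∸_; _≤_; _<_; _<?_; z≤n; s≤s)
import Data.Nat.Properties as ℕ
open import Data.Product using (Σ-syntax; ∃; _×_; _,_; proj₁; proj₂; map₂)
import Data.Product.Properties as Product
open import Data.Product.Properties using (,-injectiveʳ)
open import Data.Sum using (_⊎_; inj₁; inj₂; [_,_]′; swap)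
open import Data.Sum.Properties using (swap-involutive)
open import Data.Vec using ([]; _∷_; tabulate; here; there)
open import Data.Vec.Properties using (lookup∘tabulate; lookup⇒[]=; []=⇒lookup)
open import Function.Base using (_∘_)
open import Function.Bundles using (mk⇔)
open import Function.Definitions using (Injective)
open import Relation.Binary using (DecidableEquality; tri<; tri≈; tri>)
open import Relation.Binary.PropositionalEquality
open import Relation.Nullary using (¬_; yes; no; Dec; does; contradiction)
open import Relation.Nullary.Decidable using (dec-true; dec-false; _×-dec_)
open import Defs

-- Automorphisms of a binary relation.

record Auto {A : Set} (_~_ : A → A → Set) : Set where
  field
    to from   : A → A
    to∘from   : ∀ i → to (from i) ≡ i
    from∘to   : ∀ i → from (to i) ≡ i
    to-resp   : ∀ {i j} → i ~ j → to i ~ to j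
    from-resp : ∀ {i j} → i ~ j → from i ~ from j

inverse : ∀ {A : Set} {_~_ : A → A → Set} → Auto _~_ → Auto _~_
inverse Φ = record
  { to = from ; from = to ; to∘from = from∘to ; from∘to = to∘from
  ; to-resp = from-resp ; from-resp = to-resp }
  where open Auto Φ

Auto-map : ∀ {A : Set} {_~_ _≈_ : A → A → Set} → (∀ {i j} → i ~ j → i ≈ j) →
           (∀ {i j} → i ≈ j → i ~ j) → Auto _~_ → Auto _≈_
Auto-map f g Φ = record
  { to = to ; from = from ; to∘from = to∘from ; from∘to = from∘to
  ; to-resp = f ∘ to-resp ∘ g ; from-resp = f ∘ from-resp ∘ g }
  where open Auto Φ

-- Counting with duplicate-free lists; sizes of subsets.

-- Duplicate-free lists that agree as sets agree as bags, hence are permutations of each other.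
-- Block sizes and degrees are both computed this way.
length-unique : {A : Set} {xs ys : List A} → Unique xs → Unique ys →
  (∀ {x} → x ∈ₗ xs → x ∈ₗ ys) → (∀ {x} → x ∈ₗ ys → x ∈ₗ xs) → length xs ≡ length ys
length-unique uxs uys f g = ↭-length (∼bag⇒↭ (unique∧set⇒bag uxs uys (mk⇔ f g)))

elements : ∀ {n} → Subset n → List (Fin n)
elements []            = []
elements (inside  ∷ S) = zero ∷ map suc (elements S)
elements (outside ∷ S) = map suc (elements S)

length-elements : ∀ {n} (S : Subset n) → length (elements S) ≡ ∣ S ∣
length-elements []            = refl
length-elements (inside  ∷ S) = cong suc (trans (length-map suc (elements S)) (length-elements S))
length-elements (outside ∷ S) = trans (length-map suc (elements S)) (length-elements S)

∈-elements⁺ : ∀ {n} {x} {S : Subset n} → x ∈ S → x ∈ₗ elements S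
∈-elements⁺ here = here refl
∈-elements⁺ {S = inside  ∷ _} (there x∈S) = there (∈-map⁺ suc (∈-elements⁺ x∈S))
∈-elements⁺ {S = outside ∷ _} (there x∈S) = ∈-map⁺ suc (∈-elements⁺ x∈S)

∈-elements⁻ : ∀ {n} {x} (S : Subset n) → x ∈ₗ elements S → x ∈ S
∈-elements⁻ (inside  ∷ S) (here refl) = here
∈-elements⁻ (inside  ∷ S) (there p) with ∈-map⁻ suc p
... | _ , q , refl = there (∈-elements⁻ S q)
∈-elements⁻ (outside ∷ S) p with ∈-map⁻ suc p
... | _ , q , refl = there (∈-elements⁻ S q)

elements-unique : ∀ {n} (S : Subset n) → Unique (elements S)
elements-unique []            = []
elements-unique (inside  ∷ S) =
  All.map⁺ (All.universal (λ _ ()) (elements S)) ∷ Unique.map⁺ Fin.suc-injective (elements-unique S)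
elements-unique (outside ∷ S) = Unique.map⁺ Fin.suc-injective (elements-unique S)

∣∣-enumeration : ∀ {n k} (S : Subset n) (f : Fin k → Fin n) → Injective _≡_ _≡_ f →
  (∀ q → f q ∈ S) → (∀ {x} → x ∈ S → ∃ λ q → f q ≡ x) → ∣ S ∣ ≡ k
∣∣-enumeration {k = k} S f f-inj sound complete = begin
  ∣ S ∣                              ≡⟨ length-elements S ⟨
  length (elements S)                ≡⟨ length-unique (elements-unique S) (Unique.tabulate⁺ f-inj) to from ⟩
  length (List.tabulate f)      ≡⟨ length-tabulate f ⟩
  k                                  ∎
  where
  open ≡-Reasoning
  to : ∀ {x} → x ∈ₗ elements S → x ∈ₗ List.tabulate f
  to p with complete (∈-elements⁻ S p)
  ... | q , refl = ∈-tabulate⁺ q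
  from : ∀ {x} → x ∈ₗ List.tabulate f → x ∈ₗ elements S
  from p with ∈-tabulate⁻ p
  ... | q , refl = ∈-elements⁺ (sound q)

-- Membership in tabulated subsets and in images.

module _ {n} {P : Fin n → Set} (P? : ∀ x → Dec (P x)) where

  ∈-tabulate-does⁺ : ∀ {x} → P x → x ∈ tabulate (does ∘ P?)
  ∈-tabulate-does⁺ {x} px =
    lookup⇒[]= x _ (trans (lookup∘tabulate (does ∘ P?) x) (dec-true (P? x) px))

  ∈-tabulate-does⁻ : ∀ {x} → x ∈ tabulate (does ∘ P?) → P x
  ∈-tabulate-does⁻ {x} x∈
    with P? x | trans (sym (lookup∘tabulate (does ∘ P?) x)) ([]=⇒lookup x∈)
  ... | yes px | _ = px

∈-image⁺ : ∀ {m n} (φ : Fin m → Fin n) {S x} → x ∈ S → φ x ∈ image φ S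
∈-image⁺ φ {S} {x} x∈S =
  ∈-tabulate-does⁺ (λ w → Fin.any? λ v → (v ∈? S) ×-dec (φ v Fin.≟ w)) (x , x∈S , refl)

∈-image⁻ : ∀ {m n} (φ : Fin m → Fin n) → Injective _≡_ _≡_ φ → ∀ {S x} → φ x ∈ image φ S → x ∈ S
∈-image⁻ φ φ-inj {S} φx∈
  with ∈-tabulate-does⁻ (λ w → Fin.any? λ v → (v ∈? S) ×-dec (φ v Fin.≟ w)) φx∈
... | v , v∈S , φv≡φx = subst (_∈ S) (φ-inj φv≡φx) v∈S

-- The 2-regular hypergraph of two partitions.

-- Two partitions e true and e false of the vertices into classes of the same size 2 + k, any two
-- classes meeting in at most one vertex. The classes form a 2-regular (2 + k)-graph.
module TwoPartitions
  {n k : ℕ} {J : Set} (_≟ᴶ_ : DecidableEquality J)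
  (js : List J) (js-unique : Unique js) (js-complete : ∀ j → j ∈ₗ js)
  (e : Bool → Fin n → J)
  (slot : Bool → J → Fin (suc (suc k)) → Fin n)
  (e-slot : ∀ b j q → e b (slot b j q) ≡ j)
  (slot-injective : ∀ b j → Injective _≡_ _≡_ (slot b j))
  (slot-surjective : ∀ b x → ∃ λ q → slot b (e b x) q ≡ x)
  (simple : ∀ {x y} → (∀ b → e b x ≡ e b y) → x ≡ y)
  where

  Block : Set
  Block = Bool × J

  sides-≢ : ∀ {j j′ : J} → _≢_ {A = Block} (true , j) (false , j′)
  sides-≢ ()

  infix 4 _∈ᴮ_
  _∈ᴮ_ : Fin n → Block → Set
  x ∈ᴮ (b , j) = e b x ≡ j

  block : Block → Subset n
  block (b , j) = tabulate λ x → does (e b x ≟ᴶ j)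

  ∈-block⁺ : ∀ {x} i → x ∈ᴮ i → x ∈ block i
  ∈-block⁺ (b , j) = ∈-tabulate-does⁺ (λ x → e b x ≟ᴶ j)

  ∈-block⁻ : ∀ {x} i → x ∈ block i → x ∈ᴮ i
  ∈-block⁻ (b , j) = ∈-tabulate-does⁻ (λ x → e b x ≟ᴶ j)

  -- Distinct blocks with a common vertex lie on different sides, so `x` and `y` agree in both
  -- partitions and `simple` applies.
  meet-once : ∀ {i i′ x y} → x ∈ᴮ i → x ∈ᴮ i′ → y ∈ᴮ i → y ∈ᴮ i′ → i ≢ i′ → x ≡ y
  meet-once {true  , _} {true  , _} refl refl _ _ i≢i′ = contradiction refl i≢i′
  meet-once {false , _} {false , _} refl refl _ _ i≢i′ = contradiction refl i≢i′
  meet-once {true  , _} {false , _} refl refl p q _    = simple λ { true → sym p ; false → sym q }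
  meet-once {false , _} {true  , _} refl refl p q _    = simple λ { true → sym q ; false → sym p }

  _≟ᴮ_ : DecidableEquality Block
  _≟ᴮ_ = Product.≡-dec Bool._≟_ _≟ᴶ_

  -- A block has at least two vertices, those in slots 0 and 1, and distinct blocks cannot share
  -- both.
  block-⊆⇒≡ : ∀ {i i′} → (∀ {x} → x ∈ᴮ i → x ∈ᴮ i′) → i ≡ i′
  block-⊆⇒≡ {b , j} {i′} i⊆i′ with (b , j) ≟ᴮ i′
  ... | yes i≡i′ = i≡i′
  ... | no  i≢i′ = contradiction (slot-injective b j 0≡1) λ ()
    where
    0≡1 : slot b j zero ≡ slot b j (suc zero)
    0≡1 = meet-once (e-slot b j zero) (i⊆i′ (e-slot b j zero))
                    (e-slot b j (suc zero)) (i⊆i′ (e-slot b j (suc zero))) i≢i′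

  block-injective : Injective _≡_ _≡_ block
  block-injective {i} {i′} eq =
    block-⊆⇒≡ λ x∈ → ∈-block⁻ i′ (subst (_ ∈_) eq (∈-block⁺ i x∈))

  ∣block∣ : ∀ i → ∣ block i ∣ ≡ suc (suc k)
  ∣block∣ (b , j) = ∣∣-enumeration (block (b , j)) (slot b j) (slot-injective b j)
    (λ q → ∈-block⁺ (b , j) (e-slot b j q))
    (λ x∈ → let q , eq = slot-surjective b _ in
            q , trans (cong (λ j′ → slot b j′ q) (sym (∈-block⁻ (b , j) x∈))) eq)

  blocks : List Block
  blocks = cartesianProduct (true ∷ false ∷ []) js

  ∈-blocks : ∀ i → i ∈ₗ blocks
  ∈-blocks (true  , j) = ∈-cartesianProduct⁺ {xs = true ∷ false ∷ []} (here refl) (js-complete j)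
  ∈-blocks (false , j) = ∈-cartesianProduct⁺ {xs = true ∷ false ∷ []} (there (here refl)) (js-complete j)

  graph : KGraph (suc (suc k))
  graph = record
    { order   = n
    ; edges   = map block blocks
    ; unique  = Unique.map⁺ block-injective
                  (Unique.cartesianProduct⁺ (((λ ()) ∷ []) ∷ [] ∷ []) js-unique)
    ; uniform = All.map⁺ (All.universal ∣block∣ blocks)
    }

  isEdge⁺ : ∀ i → IsEdge graph (block i)
  isEdge⁺ i = ∈-map⁺ block (∈-blocks i)

  isEdge⁻ : ∀ {E} → IsEdge graph E → ∃ λ i → E ≡ block i
  isEdge⁻ p with ∈-map⁻ block p
  ... | i , _ , eq = i , eq

  -- The blocks through `x` are its class in each of the two partitions; they differ because their
  -- sides do.
  regular : Regular 2 graph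
  regular x = length-unique (Unique.filter⁺ (x ∈?_) (unique graph))
                            ((sides-≢ ∘ block-injective ∷ []) ∷ [] ∷ []) to from
    where
    to : ∀ {E} → E ∈ₗ filter (x ∈?_) (edges graph) →
         E ∈ₗ block (true , e true x) ∷ block (false , e false x) ∷ []
    to p with ∈-filter⁻ (x ∈?_) p
    ... | E∈ , x∈E with isEdge⁻ E∈
    ...   | i , refl with i | ∈-block⁻ i x∈E
    ...     | true  , _ | refl = here refl
    ...     | false , _ | refl = there (here refl)
    from : ∀ {E} → E ∈ₗ block (true , e true x) ∷ block (false , e false x) ∷ [] →
           E ∈ₗ filter (x ∈?_) (edges graph)
    from (here refl)         = ∈-filter⁺ (x ∈?_) (isEdge⁺ _) (∈-block⁺ _ refl)
    from (there (here refl)) = ∈-filter⁺ (x ∈?_) (isEdge⁺ _) (∈-block⁺ _ refl)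

  -- From automorphisms of the hypergraph to automorphisms of its dual.

  -- The dual graph: blocks are its nodes, and vertices of the hypergraph are its edges.
  Adj : Block → Block → Set
  Adj i i′ = i ≢ i′ × ∃ λ x → x ∈ᴮ i × x ∈ᴮ i′

  module _ (φ : Fin n → Fin n) (aut : IsAutomorphism graph φ) where
    open IsAutomorphism aut

    private
      φ-inj = proj₁ bijective

      φ⁻¹ : Fin n → Fin n
      φ⁻¹ y = proj₁ (proj₂ bijective y)

      φ∘φ⁻¹ : ∀ y → φ (φ⁻¹ y) ≡ y
      φ∘φ⁻¹ y = proj₂ (proj₂ bijective y) refl

      preserved : ∀ i → ∃ λ i′ → image φ (block i) ≡ block i′
      preserved i = isEdge⁻ (preserves (block i) (isEdge⁺ i))

      Φ : Block → Block
      Φ i = proj₁ (preserved i)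

    ∈-Φ⁺ : ∀ {x} i → x ∈ᴮ i → φ x ∈ᴮ Φ i
    ∈-Φ⁺ i x∈ =
      ∈-block⁻ (Φ i) (subst (_ ∈_) (proj₂ (preserved i)) (∈-image⁺ φ (∈-block⁺ i x∈)))

    private
      ∈-Φ⁻ : ∀ {x} i → φ x ∈ᴮ Φ i → x ∈ᴮ i
      ∈-Φ⁻ i φx∈ =
        ∈-block⁻ i (∈-image⁻ φ φ-inj (subst (_ ∈_) (sym (proj₂ (preserved i))) (∈-block⁺ (Φ i) φx∈)))

      Φ-injective : ∀ {i i′} → Φ i ≡ Φ i′ → i ≡ i′
      Φ-injective {i} {i′} eq = block-⊆⇒≡ λ x∈ → ∈-Φ⁻ i′ (subst (_ ∈ᴮ_) eq (∈-Φ⁺ i x∈))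

      two-blocks : ∀ {x i i′ c} → x ∈ᴮ i → x ∈ᴮ i′ → i ≢ i′ → x ∈ᴮ c → c ≡ i ⊎ c ≡ i′
      two-blocks {i = true  , _} {true  , _} refl refl i≢i′ _ = contradiction refl i≢i′
      two-blocks {i = false , _} {false , _} refl refl i≢i′ _ = contradiction refl i≢i′
      two-blocks {i = true  , _} {false , _} {true  , _} refl refl _ refl = inj₁ refl
      two-blocks {i = true  , _} {false , _} {false , _} refl refl _ refl = inj₂ refl
      two-blocks {i = false , _} {true  , _} {true  , _} refl refl _ refl = inj₂ refl
      two-blocks {i = false , _} {true  , _} {false , _} refl refl _ refl = inj₁ refl

      -- Take a vertex `y` of the given block. The two blocks through its preimage go to two
      -- different blocks through `y`, and no others pass through `y`, so the given block is one of
      -- them.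
      Φ-surjective : ∀ c → ∃ λ i → Φ i ≡ c
      Φ-surjective (b , j) = found
        where
        y = slot b j zero
        x = φ⁻¹ y
        y∈ : ∀ b′ → y ∈ᴮ Φ (b′ , e b′ x)
        y∈ b′ = subst (_∈ᴮ Φ (b′ , e b′ x)) (φ∘φ⁻¹ y) (∈-Φ⁺ (b′ , e b′ x) refl)
        Φ≢ : Φ (true , e true x) ≢ Φ (false , e false x)
        Φ≢ = sides-≢ ∘ Φ-injective {true , e true x} {false , e false x}
        found : ∃ λ i → Φ i ≡ (b , j)
        found = [ (λ eq → (true , e true x) , sym eq) , (λ eq → (false , e false x) , sym eq) ]′
          (two-blocks (y∈ true) (y∈ false) Φ≢ (e-slot b j zero))

      Φ⁻¹ : Block → Block
      Φ⁻¹ c = proj₁ (Φ-surjective c)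

      Φ∘Φ⁻¹ : ∀ c → Φ (Φ⁻¹ c) ≡ c
      Φ∘Φ⁻¹ c = proj₂ (Φ-surjective c)

      Φ-adj⁻ : ∀ {i i′} → Adj (Φ i) (Φ i′) → Adj i i′
      Φ-adj⁻ {i} {i′} (Φi≢ , y , y∈ , y∈′) =
        Φi≢ ∘ cong Φ , φ⁻¹ y ,
        ∈-Φ⁻ i (subst (_∈ᴮ Φ i) (sym (φ∘φ⁻¹ y)) y∈) ,
        ∈-Φ⁻ i′ (subst (_∈ᴮ Φ i′) (sym (φ∘φ⁻¹ y)) y∈′)

    adjAut : Auto Adj
    adjAut = record
      { to       = Φ
      ; from     = Φ⁻¹
      ; to∘from  = Φ∘Φ⁻¹
      ; from∘to  = λ i → Φ-injective (Φ∘Φ⁻¹ (Φ i))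
      ; to-resp   = λ { {i} {i′} (i≢ , x , x∈ , x∈′) →
                       i≢ ∘ Φ-injective , φ x , ∈-Φ⁺ i x∈ , ∈-Φ⁺ i′ x∈′ }
      ; from-resp = λ adj → Φ-adj⁻ (subst₂ Adj (sym (Φ∘Φ⁻¹ _)) (sym (Φ∘Φ⁻¹ _)) adj)
      }

  -- A vertex is determined by its two blocks, so fixing every block fixes every vertex.
  asymmetric : (∀ (Φ : Auto Adj) i → Auto.to Φ i ≡ i) → Asymmetric graph
  asymmetric rigid φ aut x = simple λ b →
    subst (φ x ∈ᴮ_) (rigid (adjAut φ aut) (b , e b x)) (∈-Φ⁺ φ aut (b , e b x) refl)

-- Links between cells.

data Link : Set where
  chord stay turn : Link

module Links
  {T : Set} (rot : Bool → T → T) (ω : T → T)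
  (rot-inverse : ∀ b t → rot (not b) (rot b t) ≡ t)
  (rot≢id : ∀ b t → rot b t ≢ t)
  (rot≢rot⁻¹ : ∀ b t → rot b t ≢ rot (not b) t)
  (ω-involutive : ∀ t → ω (ω t) ≡ t)
  (ω≢id : ∀ t → ω t ≢ t)
  (ω≢rot : ∀ b t → ω t ≢ rot b t)
  where

  -- A `turn` uses the rotation of the side where it starts, so that following the same link from
  -- the opposite side leads back.
  act : Link → Bool → T → T
  act chord b t = ω t
  act stay  b t = t
  act turn  b t = rot b t

  act-inverse : ∀ κ b t → act κ (not b) (act κ b t) ≡ t
  act-inverse chord b t = ω-involutive t
  act-inverse stay  b t = refl
  act-inverse turn  b t = rot-inverse b t

  act-inverse′ : ∀ κ b t → act κ b (act κ (not b) t) ≡ t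
  act-inverse′ κ b t =
    subst (λ b′ → act κ b′ (act κ (not b) t) ≡ t) (Bool.not-involutive b) (act-inverse κ (not b) t)

  act-injective : ∀ κ b {s t} → act κ b s ≡ act κ b t → s ≡ t
  act-injective κ b eq =
    trans (sym (act-inverse κ b _)) (trans (cong (act κ (not b)) eq) (act-inverse κ b _))

  act-injectiveˡ : ∀ κ κ′ {b t} → act κ b t ≡ act κ′ b t → κ ≡ κ′
  act-injectiveˡ chord chord eq = refl
  act-injectiveˡ chord stay  eq = contradiction eq (ω≢id _)
  act-injectiveˡ chord turn  eq = contradiction eq (ω≢rot _ _)
  act-injectiveˡ stay  chord eq = contradiction (sym eq) (ω≢id _)
  act-injectiveˡ stay  stay  eq = refl
  act-injectiveˡ stay  turn  eq = contradiction (sym eq) (rot≢id _ _)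
  act-injectiveˡ turn  chord eq = contradiction (sym eq) (ω≢rot _ _)
  act-injectiveˡ turn  stay  eq = contradiction eq (rot≢id _ _)
  act-injectiveˡ turn  turn  eq = refl

  -- What an automorphism of the graph leaves visible on the cells. Since `rot (not b)` inverts
  -- `rot b`, a symmetry that swaps the sides acts on the diagram as a reflection.
  record Symmetry : Set where
    field
      move : Bool × T → Bool × T
      opposite : ∀ {b t b′ t′} → move (b , t) ≡ (b′ , t′) → move (not b , t) ≡ (not b′ , t′)
      chords   : ∀ {b t b′ t′} → move (b , t) ≡ (b′ , t′) → move (b , ω t) ≡ (b′ , ω t′)
      turns    : ∀ {b t b′ t′} → move (b , t) ≡ (b′ , t′) → move (b , rot b t) ≡ (b′ , rot b′ t′)

  -- The bipartite graph and its near pairs.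

  module BlowUp (_≟_ : DecidableEquality T) (k : ℕ) where

    K : ℕ
    K = 3 + k

    Node : Set
    Node = Bool × (T × Fin K)

    cell : Node → Bool × T
    cell (b , t , _) = b , t

    -- A symmetric staircase table: row 0 has the chord, row 1 is all `stay`, and each later row has
    -- one more `turn`, filling up from the last column. Consecutive rows thus differ in exactly one
    -- column.
    link : Fin K → Fin K → Link
    link zero    zero    = chord
    link zero    (suc q) = stay
    link (suc r) zero    = stay
    -- The matched `r` and `q` are one less than the indices, so the test says that the indices add
    -- up to more than `K`.
    link (suc r) (suc q) = if does (suc k <? toℕ r + toℕ q) then turn else stay

    link-sym : ∀ r q → link r q ≡ link q r
    link-sym zero    zero    = refl
    link-sym zero    (suc q) = refl
    link-sym (suc r) zero    = refl
    link-sym (suc r) (suc q) =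
      cong (λ m → if does (suc k <? m) then turn else stay) (ℕ.+-comm (toℕ r) (toℕ q))

    link-turn : ∀ r q → suc k < toℕ r + toℕ q → link (suc r) (suc q) ≡ turn
    link-turn r q lt = cong (if_then turn else stay) (dec-true (suc k <? toℕ r + toℕ q) lt)

    link-stay : ∀ r q → toℕ r + toℕ q ≤ suc k → link (suc r) (suc q) ≡ stay
    link-stay r q ge =
      cong (if_then turn else stay) (dec-false (suc k <? toℕ r + toℕ q) (ℕ.≤⇒≯ ge))

    link-one : ∀ r → link r (suc zero) ≡ stay
    link-one zero    = refl
    link-one (suc r) = link-stay r zero
      (subst (_≤ suc k) (sym (ℕ.+-identityʳ (toℕ r))) (Fin.toℕ≤pred[n] r))

    link-chord : ∀ r q → link r q ≡ chord → r ≡ zero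
    link-chord zero    q       eq = refl
    link-chord (suc r) (suc q) eq with does (suc k <? toℕ r + toℕ q)
    link-chord (suc r) (suc q) () | true
    link-chord (suc r) (suc q) () | false

    link-last : link (fromℕ (2 + k)) (fromℕ (2 + k)) ≡ turn
    link-last = link-turn (fromℕ (suc k)) (fromℕ (suc k))
      (subst (λ m → suc k < m + m) (sym (Fin.toℕ-fromℕ (suc k))) (s≤s (ℕ.m≤n+m (suc k) k)))

    link-onto : ∀ κ → ∃ λ r → ∃ λ q → link r q ≡ κ
    link-onto chord = zero , zero , refl
    link-onto stay  = zero , suc zero , refl
    link-onto turn  = fromℕ (2 + k) , fromℕ (2 + k) , link-last

    step : Bool → Fin K → Fin K → T → T
    step b r q = act (link r q) b

    -- On the way back the two indices exchange roles, which the symmetry of the table allows.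
    step-inverse : ∀ b r q t → step (not b) q r (step b r q t) ≡ t
    step-inverse b r q t =
      trans (cong (λ κ → act κ (not b) (step b r q t)) (link-sym q r)) (act-inverse (link r q) b t)

    step-inverse′ : ∀ b r q t → step b r q (step (not b) q r t) ≡ t
    step-inverse′ b r q t =
      trans (cong (λ κ → act (link r q) b (act κ (not b) t)) (link-sym q r))
            (act-inverse′ (link r q) b t)

    nbr : Node → Fin K → Node
    nbr (b , t , r) q = not b , step b r q t , q

    infix 4 _~_
    _~_ : Node → Node → Set
    v ~ w = ∃ λ q → nbr v q ≡ w

    ~-sym : ∀ {v w} → v ~ w → w ~ v
    ~-sym {b , t , r} (q , refl) =
      r , cong₂ (λ b′ t′ → b′ , t′ , r) (Bool.not-involutive b) (step-inverse b r q t)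

    -- “v and w share all but at most one neighbour”, said without counting.
    Near : Node → Node → Set
    Near v w = ∀ {x y} → v ~ x → v ~ y → ¬ (x ~ w) → ¬ (y ~ w) → x ≡ y

    module _ (b : Bool) (t : T) (r : Fin K) (t′ : T) (r′ : Fin K) where

      -- A node has exactly one neighbour of each index `q`, so common neighbours of two nodes on
      -- one side are found by comparing their signatures entry by entry.
      ~-same-side⁺ : ∀ q → step b r q t ≡ step b r′ q t′ → nbr (b , t , r) q ~ (b , t′ , r′)
      ~-same-side⁺ q eq = r′ , cong₂ (λ b″ s → b″ , s , r′)
        (Bool.not-involutive b) (trans (cong (step (not b) q r′) eq) (step-inverse b r′ q t′))

      ~-same-side⁻ : ∀ q → nbr (b , t , r) q ~ (b , t′ , r′) → step b r q t ≡ step b r′ q t′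
      ~-same-side⁻ q (p , eq) with cong (proj₂ ∘ proj₂) eq
      ... | refl = trans (sym (step-inverse′ b r′ q (step b r q t)))
                         (cong (step b r′ q) (cong (proj₁ ∘ proj₂) eq))

      near-agree : Near (b , t , r) (b , t′ , r′) → ∀ q q′ → q ≢ q′ →
                   step b r q t ≢ step b r′ q t′ → step b r q′ t ≡ step b r′ q′ t′
      near-agree near q q′ q≢q′ ≢q with step b r q′ t ≟ step b r′ q′ t′
      ... | yes eq = eq
      ... | no  ≢q′ = contradiction
        (cong (proj₂ ∘ proj₂)
          (near (q , refl) (q′ , refl) (≢q ∘ ~-same-side⁻ q) (≢q′ ∘ ~-same-side⁻ q′)))
        q≢q′

      agree⇒near :
        (∀ q q′ → step b r q t ≢ step b r′ q t′ → step b r q′ t ≢ step b r′ q′ t′ → q ≡ q′) →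
        Near (b , t , r) (b , t′ , r′)
      agree⇒near eq (q , refl) (q′ , refl) x≁ y≁ =
        cong (nbr (b , t , r)) (eq q q′ (x≁ ∘ ~-same-side⁺ q) (y≁ ∘ ~-same-side⁺ q′))

    -- Two nodes of different cells t and t′ differ at 1, hence agree at 0 and at 2: the chord would
    -- join t to t′ or to a rotation of t′.
    near⇒≡ : ∀ b t r t′ r′ → Near (b , t , r) (b , t′ , r′) → t ≡ t′
    near⇒≡ b t r t′ r′ near with t ≟ t′
    ... | yes t≡t′ = t≡t′
    ... | no  t≢t′ = contradiction (agree zero λ ()) (differ-at-0 r r′ (agree two λ ()))
      where
      two : Fin K
      two = suc (suc zero)
      differ-at-1 : step b r (suc zero) t ≢ step b r′ (suc zero) t′
      differ-at-1 =
        subst₂ (λ κ κ′ → act κ b t ≢ act κ′ b t′) (sym (link-one r)) (sym (link-one r′)) t≢t′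
      agree : ∀ q → suc zero ≢ q → step b r q t ≡ step b r′ q t′
      agree q 1≢q = near-agree b t r t′ r′ near (suc zero) q 1≢q differ-at-1
      chord-end : ∀ {s s′} r → s ≡ step b (suc r) two s′ → ω s ≢ s′
      chord-end {s} {s′} r eq ωs≡s′ with does (suc k <? toℕ r + 1)
      ... | true  = ω≢rot b s′ (trans (cong ω (sym ωs≡s′)) (trans (ω-involutive s) eq))
      ... | false = ω≢id s (trans ωs≡s′ (sym eq))
      differ-at-0 : ∀ r r′ → step b r two t ≡ step b r′ two t′ → step b r zero t ≢ step b r′ zero t′
      differ-at-0 zero    zero     _  = t≢t′ ∘ act-injective chord b
      differ-at-0 zero    (suc r′) eq = chord-end r′ eq
      differ-at-0 (suc r) zero     eq = chord-end r (sym eq) ∘ sym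
      differ-at-0 (suc r) (suc r′) _  = t≢t′

    -- Nodes on different sides are never near: the graph is bipartite, so no neighbour of `v` is
    -- adjacent to `w`, while `v` has two distinct neighbours.
    near⇒cell : ∀ v w → Near v w → cell v ≡ cell w
    near⇒cell v@(b , t , r) w@(b′ , t′ , r′) near with b Bool.≟ b′
    ... | yes refl = cong (b ,_) (near⇒≡ b t r t′ r′ near)
    ... | no  b≢b′ = contradiction
      (cong (proj₂ ∘ proj₂) (near (zero , refl) (suc zero , refl) (not-~ zero) (not-~ (suc zero))))
      λ ()
      where
      not-~ : ∀ q → ¬ (nbr v q ~ w)
      not-~ q (_ , eq) = b≢b′ (trans (sym (Bool.not-involutive b)) (cong proj₁ eq))

    -- The two rows differ in one column only: column 0 for the first pair, and otherwise the column
    -- where the staircase advances.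
    near-suc : ∀ b t i → Near (b , t , inject₁ i) (b , t , suc i)
    near-suc b t i = agree⇒near b t (inject₁ i) t (suc i) (go i)
      where
      differ-at : ∀ (i : Fin (suc k)) q →
                  step b (suc (inject₁ i)) (suc q) t ≢ step b (suc (suc i)) (suc q) t →
                  toℕ i + toℕ q ≡ suc k
      differ-at i q ≢ with ℕ.<-cmp (toℕ i + toℕ q) (suc k)
      ... | tri≈ _ eq _ = eq
      ... | tri< lt _ _ = contradiction (cong (λ κ → act κ b t)
        (trans (link-stay (inject₁ i) q (ℕ.<⇒≤ (subst (λ m → m + toℕ q < suc k) (sym (Fin.toℕ-inject₁ i)) lt)))
               (sym (link-stay (suc i) q lt)))) ≢
      ... | tri> _ _ gt = contradiction (cong (λ κ → act κ b t)
        (trans (link-turn (inject₁ i) q (subst (λ m → suc k < m + toℕ q) (sym (Fin.toℕ-inject₁ i)) gt))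
               (sym (link-turn (suc i) q (ℕ.m<n⇒m<1+n gt))))) ≢
      go : ∀ i q q′ → step b (inject₁ i) q t ≢ step b (suc i) q t →
           step b (inject₁ i) q′ t ≢ step b (suc i) q′ t → q ≡ q′
      go zero    zero    zero     _ _  = refl
      go zero    (suc q) _        ≢ _  =
        contradiction (cong (λ κ → act κ b t) (sym (link-stay zero q (Fin.toℕ≤pred[n] q)))) ≢
      go zero    zero    (suc q)  _ ≢  =
        contradiction (cong (λ κ → act κ b t) (sym (link-stay zero q (Fin.toℕ≤pred[n] q)))) ≢
      go (suc i) zero    _        ≢ _  = contradiction refl ≢
      go (suc i) (suc q) zero     _ ≢  = contradiction refl ≢
      go (suc i) (suc q) (suc q′) ≢ ≢′ = cong suc (Fin.toℕ-injective
        (ℕ.+-cancelˡ-≡ (toℕ i) _ _ (trans (differ-at i q ≢) (sym (differ-at i q′ ≢′)))))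

    -- The rows differ in two columns: the first and the last if `r` is 0, and otherwise the ones
    -- given by `q₁` and `q₂`.
    not-near : ∀ b t r s → 2 + toℕ r ≤ toℕ s → ¬ Near (b , t , r) (b , t , s)
    not-near b t zero (suc s) (s≤s 1≤s) near =
      contradiction (near-agree b t zero t (suc s) near zero last (λ ()) (ω≢id t))
        (rot≢id b t ∘ sym ∘ subst (λ κ → t ≡ act κ b t) (link-turn s (fromℕ (suc k)) lt))
      where
      last : Fin K
      last = fromℕ (2 + k)
      lt : suc k < toℕ s + toℕ (fromℕ (suc k))
      lt = subst (λ m → suc k < toℕ s + m) (sym (Fin.toℕ-fromℕ (suc k))) (ℕ.+-monoˡ-≤ (suc k) 1≤s)
    not-near b t (suc r) (suc s) (s≤s r+2≤s) near =
      differ q₁ (ℕ.≤-reflexive r+q₁)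
        (ℕ.≤-trans (ℕ.≤-reflexive (cong suc (sym r+q₁))) (ℕ.+-monoˡ-≤ (toℕ q₁) (ℕ.<⇒≤ r+2≤s)))
        (near-agree b t (suc r) t (suc s) near (suc q₂) (suc q₁) q₂≢q₁
          (differ q₂ (ℕ.≤-trans (ℕ.≤-reflexive r+q₂) (ℕ.n≤1+n k))
            (ℕ.≤-trans (ℕ.≤-reflexive (cong (2 +_) (sym r+q₂))) (ℕ.+-monoˡ-≤ (toℕ q₂) r+2≤s))))
      where
      r≤k : toℕ r ≤ k
      r≤k = ℕ.≤-pred (ℕ.≤-trans (ℕ.<⇒≤ r+2≤s) (Fin.toℕ≤pred[n] s))
      -- `suc q₁` and `suc q₂` are the last two columns where row `suc r` has `stay`; at least two
      -- rows further down both entries are `turn`.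
      q₁ q₂ : Fin (2 + k)
      q₁ = fromℕ< {suc k ∸ toℕ r} (s≤s (ℕ.m∸n≤m (suc k) (toℕ r)))
      q₂ = fromℕ< {k ∸ toℕ r} (s≤s (ℕ.≤-trans (ℕ.m∸n≤m k (toℕ r)) (ℕ.n≤1+n k)))
      r+q₁ : toℕ r + toℕ q₁ ≡ suc k
      r+q₁ = trans (cong (toℕ r +_) (Fin.toℕ-fromℕ< _)) (ℕ.m+[n∸m]≡n (ℕ.m≤n⇒m≤1+n r≤k))
      r+q₂ : toℕ r + toℕ q₂ ≡ k
      r+q₂ = trans (cong (toℕ r +_) (Fin.toℕ-fromℕ< _)) (ℕ.m+[n∸m]≡n r≤k)
      q₂≢q₁ : suc q₂ ≢ suc q₁
      q₂≢q₁ eq = ℕ.1+n≢n (trans (sym r+q₁)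
        (trans (cong (λ q → toℕ r + toℕ q) (sym (Fin.suc-injective eq))) r+q₂))
      differ : ∀ q → toℕ r + toℕ q ≤ suc k → suc k < toℕ s + toℕ q →
               step b (suc r) (suc q) t ≢ step b (suc s) (suc q) t
      differ q ≤k k< eq = rot≢id b t (sym
        (subst₂ (λ κ κ′ → act κ b t ≡ act κ′ b t) (link-stay r q ≤k) (link-turn s q k<) eq))

    -- The induced action on cells.

    module Action (Φ : Auto _~_) where
      open Auto Φ

      -- `Near` is expressed through `~` alone, so neighbours of the images can be pulled back along
      -- `from`.
      to-near : ∀ v w → Near v w → Near (to v) (to w)
      to-near v w near {x} {y} v~x v~y x≁w y≁w = trans (sym (to∘from x))
        (trans (cong to (near (back x v~x) (back y v~y) (x≁w ∘ forth x) (y≁w ∘ forth y))) (to∘from y))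
        where
        back : ∀ x → to v ~ x → v ~ from x
        back x v~x = subst (_~ from x) (from∘to v) (from-resp v~x)
        forth : ∀ x → from x ~ w → x ~ to w
        forth x x~w = subst (_~ to w) (to∘from x) (to-resp x~w)

      move : Bool × T → Bool × T
      move (b , t) = cell (to (b , t , zero))

      -- The nodes of a cell form a chain of near pairs, and near nodes share a cell; hence the
      -- image of node 0 determines the image of the whole cell.
      cell-to : ∀ v → cell (to v) ≡ move (cell v)
      cell-to (b , t , r) = <-weakInduction (λ r → cell (to (b , t , r)) ≡ move (b , t)) refl
        (λ i eq → trans (sym (near⇒cell (to (b , t , inject₁ i)) (to (b , t , suc i))
                                    (to-near _ _ (near-suc b t i)))) eq) r

    move-inverse : (Φ : Auto _~_) → ∀ p → Action.move (inverse Φ) (Action.move Φ p) ≡ p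
    move-inverse Φ (b , t) =
      trans (sym (Action.cell-to (inverse Φ) (Auto.to Φ (b , t , zero)))) (cong cell (Auto.from∘to Φ _))

    module _ (Φ : Auto _~_) where
      open Auto Φ
      open Action Φ

      move-injective : ∀ {p p′} → move p ≡ move p′ → p ≡ p′
      move-injective {p} {p′} eq = trans (sym (move-inverse Φ p))
        (trans (cong (Action.move (inverse Φ)) eq) (move-inverse Φ p′))

      ~⇒cell : ∀ v w → v ~ w →
               ∃ λ κ → cell w ≡ (not (proj₁ (cell v)) , act κ (proj₁ (cell v)) (proj₂ (cell v)))
      ~⇒cell (b , t , r) _ (q , refl) = link r q , refl

      -- Each kind of link occurs somewhere in the table, hence on an edge of the graph. The image
      -- of that edge is again an edge and carries some link.
      move-link : ∀ κ {b t b′ t′} → move (b , t) ≡ (b′ , t′) →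
                  ∃ λ κ′ → move (not b , act κ b t) ≡ (not b′ , act κ′ b′ t′)
      move-link κ {b} {t} {b′} {t′} eq with link-onto κ
      ... | r , q , refl
        with ~⇒cell (to (b , t , r)) (to (nbr (b , t , r) q)) (to-resp (q , refl))
      ...   | κ′ , eq′ = κ′ , trans (sym (cell-to (nbr (b , t , r) q)))
        (subst (λ p → cell (to (nbr (b , t , r) q)) ≡ (not (proj₁ p) , act κ′ (proj₁ p) (proj₂ p)))
               (trans (cell-to (b , t , r)) eq) eq′)

      -- The neighbours of (b , t , 1) lie in the cell (not b , t), and every node has a neighbour in
      -- the cell opposite to its own.
      move-opposite : ∀ {b t b′ t′} → move (b , t) ≡ (b′ , t′) → move (not b , t) ≡ (not b′ , t′)
      move-opposite {b} {t} eq = begin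
        move (not b , t)      ≡⟨ cong move (sym from-w-cell) ⟩
        move (cell (from w))  ≡⟨ sym (cell-to (from w)) ⟩
        cell (to (from w))    ≡⟨ cong cell (to∘from w) ⟩
        cell w                ≡⟨ nbr-one (to v) ⟩
        opp (cell (to v))     ≡⟨ cong opp (trans (cell-to v) eq) ⟩
        opp (_ , _)           ∎
        where
        open ≡-Reasoning
        opp : Bool × T → Bool × T
        opp (c , s) = not c , s
        v w : Node
        v = b , t , suc zero
        w = nbr (to v) (suc zero)
        nbr-one : ∀ u → cell (nbr u (suc zero)) ≡ opp (cell u)
        nbr-one (c , s , r) = cong (λ κ → not c , act κ c s) (link-one r)
        nbr-of-one : ∀ u → v ~ u → cell u ≡ (not b , t)
        nbr-of-one _ (q , refl) =
          cong (λ κ → not b , act κ b t) (trans (link-sym (suc zero) q) (link-one q))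
        from-w-cell : cell (from w) ≡ (not b , t)
        from-w-cell =
          nbr-of-one (from w) (subst (_~ from w) (from∘to v) (from-resp (suc zero , refl)))

      move-act : ∀ κ {b t b′ t′} → move (b , t) ≡ (b′ , t′) →
                 ∃ λ κ′ → move (b , act κ b t) ≡ (b′ , act κ′ b′ t′)
      move-act κ {b} {t} {b′} {t′} eq with move-link κ eq
      ... | κ′ , eq′ = κ′ ,
        subst₂ (λ c c′ → move (c , act κ b t) ≡ (c′ , act κ′ b′ t′))
               (Bool.not-involutive b) (Bool.not-involutive b′) (move-opposite eq′)

      -- Chords are the links which run in both directions between two pairs of opposite cells.
      move-chord : ∀ {b t b′ t′} → move (b , t) ≡ (b′ , t′) → move (b , ω t) ≡ (b′ , ω t′)
      move-chord {b} {t} {b′} {t′} eq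
        with move-act chord eq | move-act chord (move-opposite eq)
      ... | κ , eq₁ | κ′ , eq₂ = trans eq₁ (cong (b′ ,_) (is-chord κ κ′ moved act≡))
        where
        moved : act κ b′ t′ ≢ t′
        moved s≡t′ = ω≢id t (,-injectiveʳ (move-injective
          (trans eq₁ (trans (cong (b′ ,_) s≡t′) (sym eq)))))
        act≡ : act κ b′ t′ ≡ act κ′ (not b′) t′
        act≡ = ,-injectiveʳ (trans (sym (move-opposite eq₁)) eq₂)
        is-chord : ∀ κ κ′ → act κ b′ t′ ≢ t′ → act κ b′ t′ ≡ act κ′ (not b′) t′ → act κ b′ t′ ≡ ω t′
        is-chord chord _     _ _  = refl
        is-chord stay  _     ≢ _  = contradiction refl ≢
        is-chord turn  chord _ eq = eq
        is-chord turn  stay  ≢ eq = contradiction eq ≢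
        is-chord turn  turn  _ eq = contradiction eq (rot≢rot⁻¹ b′ t′)

      -- The other links contradict injectivity: `stay` would give the turned cell the image of the
      -- cell itself, and `chord` the image of its chord partner.
      move-turn : ∀ {b t b′ t′} → move (b , t) ≡ (b′ , t′) → move (b , rot b t) ≡ (b′ , rot b′ t′)
      move-turn {b} {t} {b′} {t′} eq with move-act turn eq
      ... | turn  , eq′ = eq′
      ... | stay  , eq′ =
        contradiction (,-injectiveʳ (move-injective (trans eq′ (sym eq)))) (rot≢id b t)
      ... | chord , eq′ =
        contradiction (,-injectiveʳ (move-injective (trans (move-chord eq) (sym eq′)))) (ω≢rot b t)

      symmetry : Symmetry
      symmetry = record
        { move = move ; opposite = move-opposite ; chords = move-chord ; turns = move-turn }

      -- Automorphisms that fix all cells.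

      module _ (fixed : ∀ p → move p ≡ p) where

        to-cell : ∀ v → cell (to v) ≡ cell v
        to-cell v = trans (cell-to v) (fixed (cell v))

        index : Node → Fin K
        index v = proj₂ (proj₂ (to v))

        to≡ : ∀ v → to v ≡ (proj₁ v , proj₁ (proj₂ v) , index v)
        to≡ v = cong₂ (λ b t → b , t , index v) (cong proj₁ (to-cell v)) (cong proj₂ (to-cell v))

        -- With all cells fixed, a chord edge goes to an edge between the same two cells. Its link
        -- must again be the chord, which occurs only at index 0.
        index-zero : ∀ b t → index (b , t , zero) ≡ zero
        index-zero b t = link-chord _ _ (chord-link (subst₂ _~_ (to≡ v) (to≡ w) (to-resp (zero , refl))))
          where
          v w : Node
          v = b , t , zero
          w = not b , ω t , zero
          chord-link : (b , t , index v) ~ (not b , ω t , index w) → link (index v) (index w) ≡ chord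
          chord-link (q , eq) with cong (proj₂ ∘ proj₂) eq
          ... | refl = act-injectiveˡ _ chord (cong (proj₁ ∘ proj₂) eq)

        -- The image of node `suc i` is near the fixed node `inject₁ i`, so its index is at most
        -- `suc i`. Smaller indices belong to nodes already fixed, and `to` is injective.
        to-fixed-below : ∀ b t i j → toℕ j ≤ toℕ i → to (b , t , j) ≡ (b , t , j)
        to-fixed-below b t = <-weakInduction
          (λ i → ∀ j → toℕ j ≤ toℕ i → to (b , t , j) ≡ (b , t , j)) base next
          where
          base : ∀ j → toℕ j ≤ 0 → to (b , t , j) ≡ (b , t , j)
          base zero _ = trans (to≡ (b , t , zero)) (cong (λ r → b , t , r) (index-zero b t))
          next : ∀ i → (∀ j → toℕ j ≤ toℕ (inject₁ i) → to (b , t , j) ≡ (b , t , j)) →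
                 ∀ j → toℕ j ≤ suc (toℕ i) → to (b , t , j) ≡ (b , t , j)
          next i below j j≤1+i with ℕ.m≤n⇒m<n∨m≡n j≤1+i
          ... | inj₁ (s≤s j≤i) = below j (subst (toℕ j ≤_) (sym (Fin.toℕ-inject₁ i)) j≤i)
          ... | inj₂ j≡1+i = subst (λ j → to (b , t , j) ≡ (b , t , j)) (sym (Fin.toℕ-injective j≡1+i))
            (trans (to≡ u) (cong (λ r → b , t , r) (Fin.toℕ-injective index≡)))
            where
            u : Node
            u = b , t , suc i
            i≡ = Fin.toℕ-inject₁ i
            near : Near (b , t , inject₁ i) (b , t , index u)
            near = subst₂ Near (below (inject₁ i) ℕ.≤-refl) (to≡ u) (to-near _ _ (near-suc b t i))
            index≰ : ¬ (toℕ (index u) ≤ toℕ (inject₁ i))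
            index≰ ≤i = ℕ.1+n≰n (subst₂ _≤_ (cong toℕ index≡′) i≡ ≤i)
              where
              index≡′ : index u ≡ suc i
              index≡′ = cong (proj₂ ∘ proj₂) (trans (sym (from∘to _))
                (trans (cong from (trans (below (index u) ≤i) (sym (to≡ u)))) (from∘to u)))
            index≡ : toℕ (index u) ≡ suc (toℕ i)
            index≡ with ℕ.<-cmp (toℕ (index u)) (suc (toℕ i))
            ... | tri≈ _ eq _ = eq
            ... | tri< (s≤s lt) _ _ = contradiction (subst (toℕ (index u) ≤_) (sym i≡) lt) index≰
            ... | tri> _ _ gt =
              ⊥-elim (not-near b t (inject₁ i) (index u)
                (subst (λ m → 2 + m ≤ toℕ (index u)) (sym i≡) gt) near)

        to-fixed : ∀ v → to v ≡ v
        to-fixed (b , t , r) = to-fixed-below b t r r ℕ.≤-refl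

-- Rotations of a finite cycle.

next : ∀ {m} → Fin (suc m) → Fin (suc m)
next i with view i
... | ‵fromℕ     = zero
... | ‵inject₁ j = suc j

prev : ∀ {m} → Fin (suc m) → Fin (suc m)
prev zero    = fromℕ _
prev (suc i) = inject₁ i

next-inject₁ : ∀ {m} (i : Fin m) → next (inject₁ i) ≡ suc i
next-inject₁ i rewrite view-inject₁ i = refl

next-prev : ∀ {m} (i : Fin (suc m)) → next (prev i) ≡ i
next-prev {m} zero rewrite view-fromℕ m = refl
next-prev (suc i) = next-inject₁ i

prev-next : ∀ {m} (i : Fin (suc m)) → prev (next i) ≡ i
prev-next i with view i
... | ‵fromℕ     = refl
... | ‵inject₁ j = refl

toℕ-next : ∀ {m} (i : Fin (suc m)) → toℕ (next i) ≡ suc (toℕ i) ⊎ next i ≡ zero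
toℕ-next i with view i
... | ‵fromℕ     = inj₂ refl
... | ‵inject₁ j = inj₁ (cong suc (sym (Fin.toℕ-inject₁ j)))

next≢id : ∀ {m} (i : Fin (2 + m)) → next i ≢ i
next≢id i eq with toℕ-next i
... | inj₁ up   = ℕ.1+n≢n (trans (sym up) (cong toℕ eq))
... | inj₂ wrap with trans (sym eq) wrap
next≢id zero () | inj₂ _ | refl

next≢prev : ∀ {m} (i : Fin (3 + m)) → next i ≢ prev i
next≢prev zero    ()
next≢prev (suc i) eq with toℕ-next (suc i)
... | inj₁ up   = ℕ.m≢1+n+m (toℕ i) {1}
                    (trans (sym (Fin.toℕ-inject₁ i)) (trans (sym (cong toℕ eq)) up))
next≢prev (suc zero) () | inj₂ wrap
next≢prev (suc (suc i)) eq | inj₂ wrap with trans (sym wrap) eq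
... | ()

rotate : ∀ {m} → Bool → Fin (suc m) → Fin (suc m)
rotate true  = next
rotate false = prev

rotate-inverse : ∀ {m} b (i : Fin (suc m)) → rotate (not b) (rotate b i) ≡ i
rotate-inverse true  = prev-next
rotate-inverse false = next-prev

rotate≢id : ∀ {m} b (i : Fin (2 + m)) → rotate b i ≢ i
rotate≢id true  i    = next≢id i
rotate≢id false i eq = next≢id i (trans (cong next (sym eq)) (next-prev i))

rotate≢rotate⁻¹ : ∀ {m} b (i : Fin (3 + m)) → rotate b i ≢ rotate (not b) i
rotate≢rotate⁻¹ true  i = next≢prev i
rotate≢rotate⁻¹ false i = next≢prev i ∘ sym

-- A family of chord diagrams.

module ChordDiagram (a : ℕ) where

  -- The offset exceeds 3, the length of the distinguished chord {0,3}; the parameter `a` makes the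
  -- family infinite.
  l : ℕ
  l = 4 + a

  Point : Set
  Point = Fin (6 + (l + l))

  halves : Fin (l + l) → Fin (l + l)
  halves = join l l ∘ swap ∘ splitAt l

  -- Only the chord {0,3} has length 3: {1,5} has length 4, {2,4} has length 2, and the remaining
  -- chords join points `l` apart. The reflection exchanging 0 and 3 takes 1 to 2, but 5 to a point
  -- other than 4, so it does not preserve the chords.
  ω : Point → Point
  ω 0F = 3F
  ω 1F = 5F
  ω 2F = 4F
  ω 3F = 0F
  ω 4F = 2F
  ω 5F = 1F
  ω (suc (suc (suc (suc (suc (suc j)))))) = 6 ↑ʳ halves j

  halves-involutive : ∀ j → halves (halves j) ≡ j
  halves-involutive j = begin
    join l l (swap (splitAt l (join l l (swap (splitAt l j)))))
      ≡⟨ cong (join l l ∘ swap) (Fin.splitAt-join l l (swap (splitAt l j))) ⟩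
    join l l (swap (swap (splitAt l j)))
      ≡⟨ cong (join l l) (swap-involutive (splitAt l j)) ⟩
    join l l (splitAt l j)
      ≡⟨ Fin.join-splitAt l l j ⟩
    j ∎
    where open ≡-Reasoning

  toℕ-halves : ∀ j → toℕ (halves j) ≡ l + toℕ j ⊎ toℕ j ≡ l + toℕ (halves j)
  toℕ-halves j with splitAt l j in eq
  ... | inj₁ i = inj₁ (trans (Fin.toℕ-↑ʳ l i) (cong (l +_)
    (trans (sym (Fin.toℕ-↑ˡ i l)) (cong toℕ (Fin.splitAt⁻¹-↑ˡ eq)))))
  ... | inj₂ i = inj₂ (trans (cong toℕ (sym (Fin.splitAt⁻¹-↑ʳ {l} eq)))
    (trans (Fin.toℕ-↑ʳ l i) (cong (l +_) (sym (Fin.toℕ-↑ˡ i l)))))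

  -- The partner of `j` lies `l` ahead or `l` behind; a forward distance `d` below `l` fits neither.
  halves-far : ∀ d j → d < l → toℕ (halves j) ≢ d + toℕ j
  halves-far d j d<l eq with toℕ-halves j
  ... | inj₁ up   = ℕ.<⇒≢ d<l (ℕ.+-cancelʳ-≡ (toℕ j) d l (trans (sym eq) up))
  ... | inj₂ down = ℕ.m≢1+n+m (toℕ j) (trans down (trans (cong (l +_) eq) (sym (ℕ.+-assoc l d _))))

  ω-involutive : ∀ t → ω (ω t) ≡ t
  ω-involutive 0F = refl
  ω-involutive 1F = refl
  ω-involutive 2F = refl
  ω-involutive 3F = refl
  ω-involutive 4F = refl
  ω-involutive 5F = refl
  ω-involutive (suc (suc (suc (suc (suc (suc j)))))) = cong (6 ↑ʳ_) (halves-involutive j)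

  far : ∀ d j → d < l → toℕ (6 ↑ʳ halves j) ≢ d + toℕ (6 ↑ʳ j)
  far d j d<l eq = halves-far d j d<l (ℕ.+-cancelˡ-≡ 6 _ _ (begin
    6 + toℕ (halves j)  ≡⟨ eq ⟩
    d + (6 + toℕ j)     ≡⟨ ℕ.+-assoc d 6 (toℕ j) ⟨
    (d + 6) + toℕ j     ≡⟨ cong (_+ toℕ j) (ℕ.+-comm d 6) ⟩
    6 + (d + toℕ j)     ∎))
    where open ≡-Reasoning

  ω≢id : ∀ t → ω t ≢ t
  ω≢id 0F ()
  ω≢id 1F ()
  ω≢id 2F ()
  ω≢id 3F ()
  ω≢id 4F ()
  ω≢id 5F ()
  ω≢id (suc (suc (suc (suc (suc (suc j)))))) eq = far 0 j (s≤s z≤n) (cong toℕ eq)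

  ω≢next : ∀ t → ω t ≢ next t
  ω≢next 0F ()
  ω≢next 1F ()
  ω≢next 2F ()
  ω≢next 3F ()
  ω≢next 4F ()
  ω≢next 5F ()
  ω≢next (suc (suc (suc (suc (suc (suc j)))))) eq with toℕ-next (6 ↑ʳ j)
  ... | inj₁ up   = far 1 j (s≤s (s≤s z≤n)) (trans (cong toℕ eq) up)
  ... | inj₂ wrap with trans eq wrap
  ...   | ()

  -- Three steps that pass the end of the cycle stop at 0, 1 or 2, among the six special points,
  -- which `ω` does not join to the others.
  toℕ-next³ : ∀ (t : Point) → toℕ (next (next (next t))) ≡ 3 + toℕ t ⊎ toℕ (next (next (next t))) < 6
  toℕ-next³ t with toℕ-next t
  ... | inj₂ wrap = inj₂ (subst (λ s → toℕ (next (next s)) < 6) (sym wrap) (s≤s (s≤s (s≤s z≤n))))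
  ... | inj₁ up₁ with toℕ-next (next t)
  ...   | inj₂ wrap = inj₂ (subst (λ s → toℕ (next s) < 6) (sym wrap) (s≤s (s≤s z≤n)))
  ...   | inj₁ up₂ with toℕ-next (next (next t))
  ...     | inj₂ wrap = inj₂ (subst (λ s → toℕ s < 6) (sym wrap) (s≤s z≤n))
  ...     | inj₁ up₃ = inj₁ (trans up₃ (cong suc (trans up₂ (cong suc up₁))))

  ω≡next³⇒0 : ∀ t → ω t ≡ next (next (next t)) → t ≡ zero
  ω≡next³⇒0 0F _ = refl
  ω≡next³⇒0 1F ()
  ω≡next³⇒0 2F ()
  ω≡next³⇒0 3F ()
  ω≡next³⇒0 4F ()
  ω≡next³⇒0 5F ()
  ω≡next³⇒0 (suc (suc (suc (suc (suc (suc j)))))) eq with toℕ-next³ (6 ↑ʳ j)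
  ... | inj₁ up = contradiction (trans (cong toℕ eq) up) (far 3 j (s≤s (s≤s (s≤s (s≤s z≤n)))))
  ... | inj₂ lt = contradiction (subst (_< 6) (sym (cong toℕ eq)) lt) (ℕ.m+n≮m 6 (toℕ (halves j)))

  -- A chord going one step back from `t` goes one step forward from `ω t`.
  ω≢rotate : ∀ b t → ω t ≢ rotate b t
  ω≢rotate true  t    = ω≢next t
  ω≢rotate false t eq = ω≢next (ω t)
    (trans (ω-involutive t) (trans (sym (next-prev t)) (cong next (sym eq))))

  open Links rotate ω rotate-inverse rotate≢id rotate≢rotate⁻¹ ω-involutive ω≢id ω≢rotate public

  -- Rigidity of the chord diagram.

  module _ (sym-move : Symmetry) where
    open Symmetry sym-move

    -- The chord {0,3} is mapped to a chord of the same length.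
    chord-0-3 : ∀ {b s} → move (true , 0F) ≡ (b , s) → ω s ≡ rotate b (rotate b (rotate b s))
    chord-0-3 eq = ,-injectiveʳ (trans (sym (chords eq)) (turns (turns (turns eq))))

    move-0 : move (true , 0F) ≡ (true , 0F)
    move-0 with move (true , 0F) in eq
    ... | true  , s = cong (true ,_) (ω≡next³⇒0 s (chord-0-3 eq))
    -- The swapped case is a reflection taking 0 to 3. Via the turn to 1 and its chord, 5 goes to 4;
    -- via five turns from 0, it goes two steps behind 0.
    ... | false , s = contradiction
      (trans (sym (reflect-5 eq′)) (turns (turns (turns (turns (turns eq′)))))) λ ()
      where
      -- The chord runs three steps back from `s`, hence three steps forward from `ω s`; this forces
      -- `ω s` to be 0.
      s≡3 : s ≡ 3F
      s≡3 = begin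
        s        ≡⟨ ω-involutive s ⟨
        ω (ω s)  ≡⟨ cong ω (ω≡next³⇒0 (ω s) (begin
          ω (ω s)                                            ≡⟨ ω-involutive s ⟩
          s                                                  ≡⟨ next³-prev³ s ⟨
          next (next (next (prev (prev (prev s)))))          ≡⟨ cong (next ∘ next ∘ next) (chord-0-3 eq) ⟨
          next (next (next (ω s)))                           ∎)) ⟩
        3F       ∎
        where
        open ≡-Reasoning
        next³-prev³ : ∀ (s : Point) → next (next (next (prev (prev (prev s))))) ≡ s
        next³-prev³ s = trans (cong (next ∘ next) (next-prev (prev (prev s))))
          (trans (cong next (next-prev (prev s))) (next-prev s))
      eq′ : move (true , 0F) ≡ (false , 3F)
      eq′ = trans eq (cong (false ,_) s≡3)
      reflect-5 : move (true , 0F) ≡ (false , 3F) → move (true , 5F) ≡ (false , 4F)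
      reflect-5 eq = chords (turns eq)

    move-true : ∀ t → move (true , t) ≡ (true , t)
    move-true = <-weakInduction (λ t → move (true , t) ≡ (true , t)) move-0
      (λ i eq → subst (λ t → move (true , t) ≡ (true , t)) (next-inject₁ i) (turns eq))

    move-fixed : ∀ p → move p ≡ p
    move-fixed (true  , t) = move-true t
    move-fixed (false , t) = opposite (move-true t)

-- The hypergraph dual to the blown-up diagram.

module Construction (k a : ℕ) where
  open ChordDiagram a
  open BlowUp Fin._≟_ k

  private
    m : ℕ
    m = 6 + (l + l)

  size : ℕ
  size = m * (K * K)

  Edge : Set
  Edge = Fin m × Fin K × Fin K

  encode : Edge → Fin size
  encode (t , r , q) = combine t (combine r q)

  decode : Fin size → Edge
  decode x = proj₁ (remQuot {m} (K * K) x) , remQuot {K} K (proj₂ (remQuot {m} (K * K) x))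

  decode-encode : ∀ y → decode (encode y) ≡ y
  decode-encode (t , r , q) = trans
    (cong (λ p → proj₁ p , remQuot K (proj₂ p)) (Fin.remQuot-combine {m} {K * K} t (combine r q)))
    (cong (t ,_) (Fin.remQuot-combine {K} {K} r q))

  encode-decode : ∀ x → encode (decode x) ≡ x
  encode-decode x = trans
    (cong (combine (proj₁ (remQuot {m} (K * K) x)))
          (Fin.combine-remQuot {K} K (proj₂ (remQuot {m} (K * K) x))))
    (Fin.combine-remQuot {m} (K * K) x)

  -- The hypergraph vertex (t , r , q) is the edge joining (true , t , r) to its q-th neighbour.
  end : Bool → Fin m × Fin K × Fin K → Fin m × Fin K
  end true  (t , r , q) = t , r
  end false (t , r , q) = step true r q t , q

  edge : Bool → Fin m × Fin K → Fin K → Fin m × Fin K × Fin K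
  edge true  (t , r) q = t , r , q
  edge false (u , q) r = step false q r u , r , q

  end-edge : ∀ b j q → end b (edge b j q) ≡ j
  end-edge true  j       q = refl
  end-edge false (u , q) r = cong (_, q) (step-inverse′ true r q u)

  edge-injective : ∀ b j → Injective _≡_ _≡_ (edge b j)
  edge-injective true  j = cong (proj₂ ∘ proj₂)
  edge-injective false j = cong (proj₁ ∘ proj₂)

  edge-surjective : ∀ b y → ∃ λ q → edge b (end b y) q ≡ y
  edge-surjective true  (t , r , q) = q , refl
  edge-surjective false (t , r , q) = r , cong (λ s → s , r , q) (step-inverse true r q t)

  end-simple : ∀ {y y′} → (∀ b → end b y ≡ end b y′) → y ≡ y′
  end-simple eq = cong₂ (λ p q → proj₁ p , proj₂ p , q) (eq true) (cong proj₂ (eq false))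

  side : Bool → Fin size → Fin m × Fin K
  side b x = end b (decode x)

  slot : Bool → Fin m × Fin K → Fin K → Fin size
  slot b j q = encode (edge b j q)

  side-slot : ∀ b j q → side b (slot b j q) ≡ j
  side-slot b j q = trans (cong (end b) (decode-encode (edge b j q))) (end-edge b j q)

  slot-injective : ∀ b j → Injective _≡_ _≡_ (slot b j)
  slot-injective b j {q} {q′} eq = edge-injective b j (begin
    edge b j q            ≡⟨ decode-encode (edge b j q) ⟨
    decode (slot b j q)   ≡⟨ cong decode eq ⟩
    decode (slot b j q′)  ≡⟨ decode-encode (edge b j q′) ⟩
    edge b j q′           ∎)
    where open ≡-Reasoning

  slot-surjective : ∀ b x → ∃ λ q → slot b (side b x) q ≡ x
  slot-surjective b x = map₂ (λ eq → trans (cong encode eq) (encode-decode x))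
                             (edge-surjective b (decode x))

  side-simple : ∀ {x y} → (∀ b → side b x ≡ side b y) → x ≡ y
  side-simple {x} {y} eq =
    trans (sym (encode-decode x)) (trans (cong encode (end-simple eq)) (encode-decode y))

  classes : List (Fin m × Fin K)
  classes = cartesianProduct (allFin m) (allFin K)

  classes-unique : Unique classes
  classes-unique = Unique.cartesianProduct⁺ (Unique.allFin⁺ m) (Unique.allFin⁺ K)

  ∈-classes : ∀ j → j ∈ₗ classes
  ∈-classes (t , r) = ∈-cartesianProduct⁺ (∈-allFin t) (∈-allFin r)

  open TwoPartitions (Product.≡-dec (Fin._≟_ {m}) (Fin._≟_ {K})) classes classes-unique ∈-classes
    side slot side-slot slot-injective slot-surjective side-simple public

  -- Two classes on one side that meet coincide, and a common vertex of classes on different sides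
  -- is an edge between the corresponding nodes. So the dual of the hypergraph is the graph of `~`.
  Adj⇒~ : ∀ {v w} → Adj v w → v ~ w
  Adj⇒~ {true  , _} {true  , _} (v≢w , _ , refl , refl) = contradiction refl v≢w
  Adj⇒~ {false , _} {false , _} (v≢w , _ , refl , refl) = contradiction refl v≢w
  Adj⇒~ {true  , _} {false , _} (_ , x , refl , refl) = _ , refl
  Adj⇒~ {false , _} {true  , _} (_ , x , refl , refl) =
    ~-sym {true , end true (decode x)} {false , end false (decode x)} (_ , refl)

  ~⇒Adj : ∀ {v w} → v ~ w → Adj v w
  ~⇒Adj {true , t , r} (q , refl) = (λ ()) , encode (t , r , q) ,
    cong (end true) (decode-encode (t , r , q)) , cong (end false) (decode-encode (t , r , q))
  ~⇒Adj {false , j} (r , refl) = (λ ()) , slot false j r ,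
    side-slot false j r , cong (end true) (decode-encode (edge false j r))

  rigid : (Φ : Auto Adj) → ∀ v → Auto.to Φ v ≡ v
  rigid Φ = to-fixed Φ′ (move-fixed (symmetry Φ′))
    where
    Φ′ = Auto-map Adj⇒~ ~⇒Adj Φ

  graph-asymmetric : Asymmetric graph
  graph-asymmetric = asymmetric rigid

-- Telling the hypergraphs apart by their number of vertices.

≅⇒order≡ : ∀ {k} {G H : KGraph k} → G ≅ H → order G ≡ order H
≅⇒order≡ (φ , iso) = Fin.cantor-schröder-bernstein (proj₁ bijective) φ⁻¹-injective
  where
  open IsIsomorphism iso
  φ⁻¹-injective : Injective _≡_ _≡_ (λ y → proj₁ (proj₂ bijective y))
  φ⁻¹-injective {x} {y} eq = trans (sym (proj₂ (proj₂ bijective x) refl))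
    (trans (cong φ eq) (proj₂ (proj₂ bijective y) refl))

double-injective : ∀ {i j} → i + i ≡ j + j → i ≡ j
double-injective {i} {j} eq with ℕ.<-cmp i j
... | tri< lt _ _ = contradiction eq (ℕ.<⇒≢ (ℕ.+-mono-< lt lt))
... | tri≈ _ i≡j _ = i≡j
... | tri> _ _ gt = contradiction (sym eq) (ℕ.<⇒≢ (ℕ.+-mono-< gt gt))

theorem3 : (k : ℕ) → 3 ≤ k →
    Σ[ G ∈ (ℕ → KGraph k) ]
    ((∀ i → Regular 2 (G i) × Asymmetric (G i)) ×
    (∀ i j → i ≢ j → ¬ (G i ≅ G j)))
theorem3 (suc (suc (suc k))) (s≤s (s≤s (s≤s _))) = graph , (λ a → regular a , graph-asymmetric a) , λ i j i≢j iso →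
  -- The orders are `(6 + ((4 + a) + (4 + a))) * ((3 + k) * (3 +
  -- k))` with `a` equal to `i` and to `j`; the cancellations remove the square, the 6, the doubling
  -- and the 4.
  i≢j (ℕ.+-cancelˡ-≡ 4 i j (double-injective (ℕ.+-cancelˡ-≡ 6 _ _
    (ℕ.*-cancelʳ-≡ _ _ ((3 + k) * (3 + k)) (≅⇒order≡ iso)))))
  where open Construction k
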